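{- For all $n\ge 1$, $R_n\subseteq H_n$, where $R_n=\{w\in\mathfrak{S}_n : Q(w)=Q(w^r)\}$ and $H_n=\{w\in\mathfrak{S}_n : Q(w) \text{ has symmetric hook shape}\}$. That is, $Q(w)$ has a symmetric hook shape for every $w\in\mathfrak{S}_n$ with $Q(w)=Q(w^r)$.
   Context: Permutations are written in one-line notation $w=w_1\dots w_n$, and $w^r=w_n\dots w_1$. $Q(w)$ denotes the recording tableau of $w$ under the Robinson–Schensted correspondence (Schensted row insertion of $w_1,\dots,w_n$; the cell containing $k$ in $Q(w)$ is the cell created at the $k$-th insertion). A shape is symmetric if it equals its transpose; a hook shape is of the form $(k,1^{n-k})$. A symmetric hook shape of size $n$ is $((n+1)/2,1^{(n-1)/2})$ with $n$ odd (for $n=1$, the single box, so $H_1=\mathfrak{S}_1$); in particular $H_n=\emptyset$ for even $n$. -}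

module Defs where

open import Data.Nat using (ℕ; zero; suc; _<?_; _≤?_)
open import Data.Fin using (Fin; toℕ)
open import Data.Fin.Permutation using (Permutation′; _⟨$⟩ʳ_)
open import Data.List using (List; []; _∷_; [_]; _++_; map; length; filter; reverse; replicate; allFin; upTo)
open import Data.Maybe using (Maybe; just; nothing)
open import Data.Product using (_×_; _,_; proj₁; proj₂; ∃-syntax)
open import Relation.Nullary using (yes; no)
open import Relation.Binary.PropositionalEquality using (_≡_)

-- One-line notation of a permutation w ∈ 𝔖_n (values shifted to 0..n-1,
-- which is order-isomorphic to 1..n and does not affect Q).
oneLine : ∀ {n} → Permutation′ n → List ℕ
oneLine {n} w = map (λ i → toℕ (w ⟨$⟩ʳ i)) (allFin n)

-- A tableau is a list of rows (top row first), each row left to right.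
Tableau : Set
Tableau = List (List ℕ)

insertRow : ℕ → List ℕ → Maybe ℕ × List ℕ
insertRow x [] = nothing , [ x ]
insertRow x (y ∷ ys) with x <? y
... | yes _ = just y , x ∷ ys
... | no _ with insertRow x ys
...   | b , ys' = b , y ∷ ys'

insertP : ℕ → Tableau → Tableau × ℕ
insertP x [] = [ [ x ] ] , 0
insertP x (r ∷ rs) with insertRow x r
... | nothing , r' = r' ∷ rs , 0
... | just y , r' with insertP y rs
...   | rs' , i = r' ∷ rs' , suc i

addAt : ℕ → ℕ → Tableau → Tableau
addAt k zero [] = [ [ k ] ]
addAt k zero (r ∷ rs) = (r ++ [ k ]) ∷ rs
addAt k (suc i) [] = [ [ k ] ]
addAt k (suc i) (r ∷ rs) = r ∷ addAt k i rs

rsGo : ℕ → List ℕ → Tableau → Tableau → Tableau × Tableau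
rsGo k [] P Q = P , Q
rsGo k (x ∷ xs) P Q with insertP x P
... | P' , i = rsGo (suc k) xs P' (addAt k i Q)

RS : List ℕ → Tableau × Tableau
RS xs = rsGo 1 xs [] []

Q : ∀ {n} → Permutation′ n → Tableau
Q w = proj₂ (RS (oneLine w))

Qrev : ∀ {n} → Permutation′ n → Tableau
Qrev w = proj₂ (RS (reverse (oneLine w)))

shape : Tableau → List ℕ
shape = map length

transpose : List ℕ → List ℕ
transpose [] = []
transpose (l₁ ∷ ls) =
  map (λ j → length (filter (λ m → suc j ≤? m) (l₁ ∷ ls))) (upTo l₁)

IsHook : List ℕ → Set
IsHook λs = ∃[ k ] ∃[ m ] (λs ≡ suc k ∷ replicate m 1)

IsSymmetricHook : List ℕ → Set
IsSymmetricHook λs = IsHook λs × (transpose λs ≡ λs)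

{-# OPTIONS --safe #-}
module Submission where

-- Write sh(w) for the shape of P(w).  Deleting the maximal letter m of a word turns row
-- insertion into Fomin's growth rule: if the new cell is the cell of m, then m moves on to the
-- next row, and otherwise it stays.  By induction on the length of x u y, always deleting the
-- maximal letter, this local rule yields at once
--   (1) sh(w) = sh(w^r)ᵗ, and
--   (2) if sh(x u) = sh(u y) = sh(u) + c and sh(x u y) = sh(x u) + d, then d is adjacent to c.
-- By (2) the shapes of u, u y and x u y determine that of x u, so Q(w) determines Q of w
-- without its first letter.  Hence if Q(w) = Q(w^r) and w = x u y, then also Q(u) = Q(u^r): both
-- sides lose their first letter and then their last.  Finally sh(w) is symmetric by (1), and
-- arises from the symmetric hook sh(u) by adding two cells; these are exchanged by
-- transposition, so neither of them is diagonal and sh(w) is again a symmetric hook.  For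
-- even length the same remark excludes the step from the empty word.

open import Defs
open import Data.Empty using (⊥)
open import Data.Fin.Permutation using (Permutation′)
open import Data.Fin.Properties using (toℕ-injective)
open import Data.List
  using (List; []; _∷_; [_]; _++_; length; reverse; replicate; filter; allFin; applyUpTo; foldl;
         initLast; _∷ʳ′_)
open import Data.List.Properties
  using (++-assoc; ++-identityʳ; foldl-++; length-++; length-reverse; reverse-++; length-map;
         length-tabulate; length-replicate; map-applyUpTo; filter-all; filter-accept; filter-none;
         reverse-involutive; unfold-reverse; ∷ʳ-++; ∷-injective; ∷ʳ-injective)
open import Data.List.Relation.Binary.Permutation.Propositional using (_↭_; ↭-sym; ↭⇒↭ₛ)
open import Data.List.Relation.Binary.Permutation.Propositional.Properties
  using (shift; ↭-reverse; All-resp-↭)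
import Data.List.Relation.Binary.Permutation.Setoid.Properties as Permₛ
open import Data.List.Relation.Unary.All as All using (All; []; _∷_)
import Data.List.Relation.Unary.All.Properties as All
open import Data.List.Relation.Unary.AllPairs using (_∷_)
open import Data.List.Relation.Unary.Unique.Propositional using (Unique)
import Data.List.Relation.Unary.Unique.Propositional.Properties as Unique
open import Data.Maybe using (just; nothing)
open import Data.Nat using (ℕ; zero; suc; _+_; _≤_; _<_; _<?_; _≤?_; z≤n; s≤s)
open import Data.Nat.Properties hiding (_<?_; _≤?_)
import Data.Product as Product
open import Data.Product using (_×_; _,_; proj₁; proj₂; ∃-syntax; swap)
open import Data.Product.Properties using (≡-dec)
import Data.Sum as Sum
open import Data.Sum using (_⊎_; inj₁; inj₂)
open import Function.Bundles using (Injection)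
open import Function.Properties.Inverse using (↔⇒↣)
open import Relation.Binary.Definitions using (DecidableEquality; tri<; tri≈; tri>)
open import Relation.Binary.PropositionalEquality
  using (_≡_; _≢_; refl; sym; trans; cong; cong₂; subst; subst₂; setoid)
open import Relation.Nullary using (¬_; Dec; yes; no; contradiction)
open import Relation.Unary using (_⊆_; _≐_)
open import Relation.Unary.Properties using (≐-refl; ≐-sym; ≐-trans)

-- Diagrams and their corners

Cell : Set
Cell = ℕ × ℕ

row col : Cell → ℕ
row = proj₁
col = proj₂

_≟ᶜ_ : DecidableEquality Cell
_≟ᶜ_ = ≡-dec _≟_ _≟_

right below : Cell → Cell
right (i , j) = i , suc j
below (i , j) = suc i , j

-- Predicates on cells, compared by `_≐_`, make transposition a mere swap of coordinates, so that
-- each fact about rows yields its analogue for columns.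
Diagram : Set₁
Diagram = Cell → Set

_ᵀ : Diagram → Diagram
(A ᵀ) p = A (swap p)

Young : Diagram → Set
Young A = ∀ {i j i' j'} → i' ≤ i → j' ≤ j → A (i , j) → A (i' , j')

record Add (A : Diagram) (c : Cell) (B : Diagram) : Set where
  constructor add
  field
    fresh : ¬ A c
    incl  : A ⊆ B
    new   : B c
    split : ∀ {p} → B p → A p ⊎ p ≡ c

open Add

ᵀ-resp : ∀ {A B} → A ≐ B → A ᵀ ≐ B ᵀ
ᵀ-resp (f , g) = (λ {p} → f {swap p}) , (λ {p} → g {swap p})

Young-ᵀ : ∀ {A} → Young A → Young (A ᵀ)
Young-ᵀ y a b = y b a

Add-ᵀ : ∀ {A c B} → Add A c B → Add (A ᵀ) (swap c) (B ᵀ)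
Add-ᵀ (add f i n s) = add f (λ {p} → i {swap p}) n
  λ {p} b → Sum.map₂ (cong swap) (s {swap p} b)

Add-resp : ∀ {A A' c B B'} → A ≐ A' → B ≐ B' → Add A c B → Add A' c B'
Add-resp (f , g) (h , k) (add fr i n s) =
  add (λ a → fr (g a)) (λ a → h (i (g a))) (h n) λ b → Sum.map₁ f (s (k b))

cell-unique : ∀ {A c d B} → Add A c B → Add A d B → c ≡ d
cell-unique p q with split q (new p)
... | inj₁ a = contradiction a (fresh p)
... | inj₂ e = e

Add-det : ∀ {A c B B'} → Add A c B → Add A c B' → B ≐ B'
Add-det {A} {c} p q = go p q , go q p
  where
  go : ∀ {B B'} → Add A c B → Add A c B' → B ⊆ B'
  go p q b with split p b
  ... | inj₁ a = incl q a
  ... | inj₂ refl = new q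

-- The cell `d` lies in `E`, but not in `A`, and is not `c`; so it can only be the cell that `E`
-- adds to `B`.
other-cell : ∀ {A c d d' B C E} → c ≢ d →
  Add A c B → Add A d C → Add B d' E → C ⊆ E → d' ≡ d
other-cell c≢d p q r sub with split r (sub (new q))
... | inj₂ e = sym e
... | inj₁ b with split p b
...   | inj₁ a = contradiction a (fresh q)
...   | inj₂ e = contradiction (sym e) c≢d

Add-exchange : ∀ {A c d B C E} → c ≢ d →
  Add A c B → Add A d C → Add B d E → Add C c E
Add-exchange {A} {c} {d} {B} {C} {E} c≢d p q r = add fr inc (incl r (new p)) spl
  where
  fr : ¬ C c
  fr x with split q x
  ... | inj₁ a = fresh p a
  ... | inj₂ e = c≢d e
  inc : C ⊆ E
  inc x with split q x
  ... | inj₁ a = incl r (incl p a)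
  ... | inj₂ refl = new r
  spl : ∀ {p} → E p → C p ⊎ p ≡ c
  spl x with split r x
  ... | inj₂ refl = inj₁ (new q)
  ... | inj₁ b with split p b
  ...   | inj₁ a = inj₁ (incl q a)
  ...   | inj₂ e = inj₂ e

-- If the cells differed, the left one would belong to the Young diagram made by adding the right
-- one, although it is neither that cell nor in `A`.
row-unique : ∀ {A c d B C} → Young B → Young C →
  Add A c B → Add A d C → row c ≡ row d → c ≡ d
row-unique {c = i , j} {.i , j'} yB yC p q refl with <-cmp j j'
... | tri≈ _ refl _ = refl
... | tri< j<j' j≢j' _ with split q (yC ≤-refl (<⇒≤ j<j') (new q))
...   | inj₁ a = contradiction a (fresh p)
...   | inj₂ e = contradiction (cong col e) j≢j'
row-unique {c = i , j} {.i , j'} yB yC p q refl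
    | tri> _ j≢j' j'<j with split p (yB ≤-refl (<⇒≤ j'<j) (new p))
...   | inj₁ a = contradiction a (fresh q)
...   | inj₂ e = contradiction (sym (cong col e)) j≢j'

col-unique : ∀ {A c d B C} → Young B → Young C →
  Add A c B → Add A d C → col c ≡ col d → c ≡ d
col-unique yB yC p q e =
  cong swap (row-unique (Young-ᵀ yB) (Young-ᵀ yC) (Add-ᵀ p) (Add-ᵀ q) e)

same-row : ∀ {A c d B C} → Young A → Young B → Young C →
  Add A c B → Add B d C → row d ≡ row c → d ≡ right c
same-row {c = i , j} {.i , j'} yA yB yC p q refl with <-cmp j' (suc j)
... | tri≈ _ refl _ = refl
... | tri< (s≤s j'≤j) _ _ = contradiction (yB ≤-refl j'≤j (new p)) (fresh q)
... | tri> _ _ j<j' with split q (yC ≤-refl (<⇒≤ j<j') (new q))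
...   | inj₂ e = contradiction (cong col e) (<⇒≢ j<j')
...   | inj₁ b with split p b
...     | inj₁ a = contradiction (yA ≤-refl (n≤1+n j) a) (fresh p)
...     | inj₂ e = contradiction (cong col e) 1+n≢n

same-col : ∀ {A c d B C} → Young A → Young B → Young C →
  Add A c B → Add B d C → col d ≡ col c → d ≡ below c
same-col yA yB yC p q e =
  cong swap (same-row (Young-ᵀ yA) (Young-ᵀ yB) (Young-ᵀ yC) (Add-ᵀ p) (Add-ᵀ q) e)

-- Growth rules and the cube of shapes

Adjacent : Cell → Cell → Set
Adjacent c d = d ≡ right c ⊎ d ≡ below c

-- The local form of (2). The condition is empty unless `X` and `Y` add the same cell to `α`.
AdjacentSquare : (α X Y δ : Diagram) → Set
AdjacentSquare α X Y δ = ∀ {c d} → Add α c X → Add α c Y → Add X d δ → Adjacent c d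

-- Where a displaced maximal letter goes: `NextRow` belongs to row insertion, `NextCol` to its
-- transpose, column insertion.
NextRow NextCol : Cell → Cell → Set
NextRow c d = row d ≡ suc (row c)
NextCol c d = col d ≡ suc (col c)

-- The growth rule: γ inserts a letter into α, β adds the maximal letter to α, and δ does both.
data Step (N : Cell → Cell → Set) (α β γ δ : Diagram) : Set where
  apart  : ∀ {c e} → c ≢ e → Add α c γ → Add α e β → Add γ e δ → Step N α β γ δ
  bumped : ∀ {c c'} → Add α c γ → Add α c β → N c c' → Add γ c' δ → Step N α β γ δ

Step-ᵀ : ∀ {N M α β γ δ} → (∀ {c d} → N c d → M (swap c) (swap d)) →
  Step N α β γ δ → Step M (α ᵀ) (β ᵀ) (γ ᵀ) (δ ᵀ)
Step-ᵀ f (apart c≢e p q r) = apart (λ e → c≢e (cong swap e)) (Add-ᵀ p) (Add-ᵀ q) (Add-ᵀ r)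
Step-ᵀ f (bumped p q n r) = bumped (Add-ᵀ p) (Add-ᵀ q) (f n) (Add-ᵀ r)

Step-resp : ∀ {N α β γ δ α' β' γ' δ'} → α ≐ α' → β ≐ β' → γ ≐ γ' → δ ≐ δ' →
  Step N α β γ δ → Step N α' β' γ' δ'
Step-resp a b g d (apart c≢e p q r) =
  apart c≢e (Add-resp a g p) (Add-resp a b q) (Add-resp g d r)
Step-resp a b g d (bumped p q n r) =
  bumped (Add-resp a g p) (Add-resp a b q) n (Add-resp g d r)

-- The cube of shapes of the words obtained from x u y by deleting some of x, y and the
-- maximal letter m of u: subscript 0 marks the deletion of m, and δ, δ' are the shapes of
-- x u y computed by row insertion of y and by column insertion of x.
record Cube (α β X₀ X Y₀ Y γ δ δ' : Diagram) : Set where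
  field
    yβ : Young β
    yX₀ : Young X₀
    yX : Young X
    yY₀ : Young Y₀
    yY : Young Y
    yγ : Young γ
    yδ : Young δ
    yδ' : Young δ'
    u∙y  : Step NextRow α β Y₀ Y
    x∙u  : Step NextCol α β X₀ X
    xu∙y : Step NextRow X₀ X γ δ
    x∙uy : Step NextCol Y₀ Y γ δ'
    adj  : AdjacentSquare α X₀ Y₀ γ

  adjY : ∀ {c d} → Add α c Y₀ → Add α c X₀ → Add Y₀ d γ → Adjacent c d
  adjY p q r = adj q p (Add-resp (Add-det p q) ≐-refl r)

Adjacent-swap : ∀ {c d} → Adjacent c d → Adjacent (swap c) (swap d)
Adjacent-swap (inj₁ refl) = inj₂ refl
Adjacent-swap (inj₂ refl) = inj₁ refl

step-apart : ∀ {N α β γ δ c e} → Step N α β γ δ →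
  Add α c γ → Add α e β → c ≢ e → Add γ e δ
step-apart (apart _ p q r) p' q' c≢e with refl ← cell-unique q q' = r
step-apart (bumped p q _ _) p' q' c≢e =
  contradiction (trans (cell-unique p' p) (cell-unique q q')) c≢e

step-bumped : ∀ {N α β γ δ c} → Step N α β γ δ →
  Add α c γ → Add α c β → ∃[ c' ] (N c c' × Add γ c' δ)
step-bumped (apart c≢e p q _) p' q' =
  contradiction (trans (cell-unique p p') (cell-unique q' q)) c≢e
step-bumped (bumped p _ n r) p' q' with refl ← cell-unique p p' = _ , n , r

step-cell : ∀ {N α β γ δ} → Step N α β γ δ → ∃[ c ] Add α c γ
step-cell (apart _ p _ _) = _ , p
step-cell (bumped p _ _ _) = _ , p

step-incl : ∀ {N α β γ δ} → Step N α β γ δ → α ⊆ γ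
step-incl s = incl (proj₂ (step-cell s))

-- Case analysis of the cube

module _ {α β X₀ X Y₀ Y γ δ δ'} (cube : Cube α β X₀ X Y₀ Y γ δ δ') where
  open Cube cube

  -- Transposition exchanges row insertion on the right with column insertion on the left, hence the
  -- roles of x and y.
  Cube-ᵀ : Cube (α ᵀ) (β ᵀ) (Y₀ ᵀ) (Y ᵀ) (X₀ ᵀ) (X ᵀ) (γ ᵀ) (δ' ᵀ) (δ ᵀ)
  Cube-ᵀ = record
    { yβ = Young-ᵀ yβ
    ; yX₀ = Young-ᵀ yY₀ ; yX = Young-ᵀ yY ; yY₀ = Young-ᵀ yX₀ ; yY = Young-ᵀ yX
    ; yγ = Young-ᵀ yγ ; yδ = Young-ᵀ yδ' ; yδ' = Young-ᵀ yδ
    ; u∙y = Step-ᵀ (λ n → n) x∙u ; x∙u = Step-ᵀ (λ n → n) u∙y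
    ; xu∙y = Step-ᵀ (λ n → n) x∙uy ; x∙uy = Step-ᵀ (λ n → n) xu∙y
    ; adj = λ p q r → Adjacent-swap (adjY (Add-ᵀ p) (Add-ᵀ q) (Add-ᵀ r))
    }

  -- The induction step for (1) and (2): both computations of the shape of x u y agree, and the
  -- adjacency given by `adj` without m persists with m restored.
  Conclusion : Set
  Conclusion = (δ ≐ δ') × AdjacentSquare β X Y δ

  commonX : ∀ {c d} → c ≢ d → Add α c X₀ → Add α d Y₀ → Add X₀ d γ
  commonX c≢d p q with d' , r ← step-cell xu∙y
    with refl ← other-cell c≢d p q r (step-incl x∙uy) = r

  -- The cells of x, y and m are pairwise different, so all additions commute; adjacency is vacuous
  -- because `X` and `Y` add different cells to `β`.
  distinct : ∀ {cx cy e} → cx ≢ cy → Add α e β → Add α cx X₀ → Add α cy Y₀ →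
    cx ≢ e → cy ≢ e → Add X₀ e X → Add Y₀ e Y → Conclusion
  distinct cx≢cy e+ x+ y+ cx≢e cy≢e X+ Y+ =
    Add-det (step-apart xu∙y X₀+cy X+ cy≢e) (step-apart x∙uy Y₀+cx Y+ cx≢e) ,
    λ p q _ → contradiction
      (trans (cell-unique (Add-exchange cx≢e x+ e+ X+) p)
             (cell-unique q (Add-exchange cy≢e y+ e+ Y+))) cx≢cy
    where
    X₀+cy = commonX cx≢cy x+ y+
    Y₀+cx = Add-exchange cx≢cy x+ y+ X₀+cy

  -- Here x and y compete for `c` while m sits at another corner `e`. The second cell `d` of `γ` is
  -- adjacent to `c`, and it is not `e`, since otherwise `β` would have a hole at `c`. So m never
  -- moves.
  coincide : ∀ {c e} → Add α e β → Add α c X₀ → Add α c Y₀ →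
    c ≢ e → Add X₀ e X → Add Y₀ e Y → Conclusion
  coincide {c} {e} e+ x+ y+ c≢e X+ Y+ with d , X₀+d ← step-cell xu∙y =
    Add-det δ+ (step-apart x∙uy (Add-resp (Add-det x+ y+) ≐-refl X₀+d) Y+ d≢e) ,
    adj'
    where
    adjacent = adj x+ y+ X₀+d
    α∌ : ∀ {d} → Adjacent c d → d ≢ e
    α∌ (inj₁ refl) refl with split e+ (yβ ≤-refl (n≤1+n _) (new e+))
    ... | inj₁ a = fresh x+ a
    ... | inj₂ e = c≢e e
    α∌ (inj₂ refl) refl with split e+ (yβ (n≤1+n _) ≤-refl (new e+))
    ... | inj₁ a = fresh x+ a
    ... | inj₂ e = c≢e e
    d≢e = α∌ adjacent
    δ+ = step-apart xu∙y X₀+d X+ d≢e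
    adj' : AdjacentSquare β X Y δ
    adj' p q r
      with refl ← cell-unique p (Add-exchange c≢e x+ e+ X+)
         | refl ← cell-unique r (Add-exchange d≢e X₀+d X+ δ+) = adjacent

  -- Here x takes the cell `c` of m and drives m to `f`, while y takes another cell `cy`. The
  -- outcome depends on whether `cy` is `f`.
  bumpedX : ∀ {c cy f} → c ≢ cy → Add α c β → Add α c X₀ → Add α cy Y₀ →
    NextCol c f → Add X₀ f X → Add Y₀ c Y → Conclusion
  bumpedX {c} {cy} {f} c≢cy e+ x+ y+ nf X+ Y+ = go (f ≟ᶜ cy)
    where
    X₀+cy = commonX c≢cy x+ y+
    Y₀+c = Add-exchange c≢cy x+ y+ X₀+cy
    toβ : ∀ {d B} → Add β d B → Add X₀ d B
    toβ = Add-resp (Add-det e+ x+) ≐-refl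
    go : Dec (f ≡ cy) → Conclusion
    -- Only x displaces m. Both computations add a cell to `γ` in the column after that of `c`, and
    -- there is only one such corner.
    go (no f≢cy) with f' , nf' , δ'+ ← step-bumped x∙uy Y₀+c Y+
      with δ+ ← step-apart xu∙y X₀+cy X+ (λ e → f≢cy (sym e))
      with refl ← col-unique yδ yδ' δ+ δ'+ (trans nf (sym nf')) =
      Add-det δ+ δ'+ ,
      λ p q _ → contradiction
        (trans (cell-unique X+ (toβ p))
               (cell-unique q (Add-exchange (λ e → c≢cy (sym e)) y+ e+ Y+))) f≢cy
    -- Column insertion sends m to the column of `cy`, hence to the cell just below `cy`; row
    -- insertion sends it from `cy` to the next row. These corners coincide.
    go (yes refl) with f' , nf' , δ'+ ← step-bumped x∙uy Y₀+c Y+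
      with f'' , nf'' , δ+ ← step-bumped xu∙y X₀+cy X+
      with refl ← same-col yX₀ yγ yδ' X₀+cy δ'+ (trans nf' (sym nf))
      with refl ← row-unique yδ yδ' δ+ δ'+ nf'' = Add-det δ+ δ'+ , adj'
      where
      adj' : AdjacentSquare β X Y δ
      adj' p q r
        with refl ← cell-unique (toβ p) X+
           | refl ← cell-unique r (Add-resp (Add-det X₀+cy X+) ≐-refl δ+)
        = inj₂ refl

  -- All three letters compete for `c`. By `adj` the second cell of `γ` is right of or below `c`, so
  -- it is `f` or `g`, and m ends at the other one. Adjacency is vacuous because `f` and `g` differ.
  bumpedXY : ∀ {c f g} → Add α c β → Add α c X₀ → Add α c Y₀ →
    NextCol c f → NextRow c g → Add X₀ f X → Add Y₀ g Y → Conclusion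
  bumpedXY {c} {f} {g} e+ x+ y+ nf ng X+ Y+
    with d , X₀+d ← step-cell xu∙y = go (adj x+ y+ X₀+d) X₀+d
    where
    toX : ∀ {d B} → Add Y₀ d B → Add X₀ d B
    toX = Add-resp (Add-det y+ x+) ≐-refl
    toY : ∀ {d B} → Add X₀ d B → Add Y₀ d B
    toY = Add-resp (Add-det x+ y+) ≐-refl
    toβ : ∀ {d B} → Add β d B → Add X₀ d B
    toβ = Add-resp (Add-det e+ x+) ≐-refl
    go : ∀ {d} → Adjacent c d → Add X₀ d γ → Conclusion
    go (inj₁ refl) X₀+d
      with refl ← col-unique yγ yX X₀+d X+ (sym nf)
      with f'' , nf'' , δ+ ← step-bumped xu∙y X₀+d X+ =
        Add-det (subst (λ z → Add γ z δ) g≡ δ+) δ'+ ,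
        λ p q _ → contradiction
          (trans (sym ng) (cong row (trans (cell-unique (toX Y+) (toβ q)) (cell-unique (toβ p) X+)))) 1+n≢n
      where
      δ'+ = step-apart x∙uy (toY X₀+d) Y+ λ e → 1+n≢n (trans (sym ng) (sym (cong row e)))
      g≡ = row-unique yδ yδ' δ+ δ'+ (trans nf'' (sym ng))
    go (inj₂ refl) X₀+d
      with refl ← row-unique yγ yY (toY X₀+d) Y+ (sym ng)
      with g'' , ng'' , δ'+ ← step-bumped x∙uy (toY X₀+d) Y+ =
        Add-det δ+ (subst (λ z → Add γ z δ') f≡ δ'+) ,
        λ p q r → contradiction
          (trans (sym nf) (cong col (trans (cell-unique X+ (toβ p)) (cell-unique (toβ q) (toX Y+))))) 1+n≢n
      where
      δ+ = step-apart xu∙y X₀+d X+ λ e → 1+n≢n (trans (sym nf) (sym (cong col e)))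
      f≡ = col-unique yδ' yδ δ'+ δ+ (trans ng'' (sym nf))

Conclusion-ᵀ : ∀ {α β X₀ X Y₀ Y γ δ δ'} (cube : Cube α β X₀ X Y₀ Y γ δ δ') →
  Conclusion (Cube-ᵀ cube) → Conclusion cube
Conclusion-ᵀ cube (δ'≐δ , adj) = ≐-sym (ᵀ-resp δ'≐δ) , λ p q r →
  Adjacent-swap (adj (Add-ᵀ q) (Add-ᵀ p)
    (Add-ᵀ (Add-resp (Add-det p q) (≐-sym (ᵀ-resp δ'≐δ)) r)))

cube-conclusion : ∀ {α β X₀ X Y₀ Y γ δ δ'} (cube : Cube α β X₀ X Y₀ Y γ δ δ') → Conclusion cube
cube-conclusion cube with Cube.u∙y cube | Cube.x∙u cube
... | apart {cy} cy≢e y+ e+ Y+ | apart {cx} cx≢e x+ e'+ X+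
    with refl ← cell-unique e+ e'+ | cx ≟ᶜ cy
...   | yes refl  = coincide cube e+ x+ y+ cx≢e X+ Y+
...   | no cx≢cy = distinct cube cx≢cy e+ x+ y+ cx≢e cy≢e X+ Y+
cube-conclusion cube
    | apart cy≢e y+ e+ Y+ | bumped x+ e'+ nf X+
    with refl ← cell-unique e+ e'+ = bumpedX cube (λ e → cy≢e (sym e)) e+ x+ y+ nf X+ Y+
cube-conclusion cube
    | bumped y+ e+ ng Y+ | apart cx≢e x+ e'+ X+
    with refl ← cell-unique e+ e'+ =
      Conclusion-ᵀ cube (bumpedX (Cube-ᵀ cube) (λ e → cx≢e (sym (cong swap e)))
        (Add-ᵀ e+) (Add-ᵀ y+) (Add-ᵀ x+) ng (Add-ᵀ Y+) (Add-ᵀ X+))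
cube-conclusion cube
    | bumped y+ e+ ng Y+ | bumped x+ e'+ nf X+
    with refl ← cell-unique e+ e'+ = bumpedXY cube e+ x+ y+ nf ng X+ Y+

-- Row insertion

insertRow-< : ∀ {x y} r → x < y → insertRow x (y ∷ r) ≡ (just y , x ∷ r)
insertRow-< {x} {y} r x<y with x <? y
... | yes _ = refl
... | no x≮y = contradiction x<y x≮y

insertRow-≮ : ∀ {x y b r r'} → ¬ x < y →
  insertRow x r ≡ (b , r') → insertRow x (y ∷ r) ≡ (b , y ∷ r')
insertRow-≮ {x} {y} x≮y eq with x <? y
... | yes x<y = contradiction x<y x≮y
... | no _ rewrite eq = refl

insertRow-max : ∀ {x r} → All (_< x) r → insertRow x r ≡ (nothing , r ++ [ x ])
insertRow-max [] = refl
insertRow-max (y<x ∷ ps) = insertRow-≮ (<-asym y<x) (insertRow-max ps)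

-- Each case also records the effect of a letter `m` at the end of the row: in the first case it is
-- bumped if it exceeds `x`, in the second it stays.
data InsertRow (x : ℕ) (r : List ℕ) : Set where
  appends : insertRow x r ≡ (nothing , r ++ [ x ]) →
    (∀ {m} → x < m → insertRow x (r ++ [ m ]) ≡ (just m , r ++ [ x ])) → InsertRow x r
  bumps : ∀ {b r'} → insertRow x r ≡ (just b , r') →
    (∀ m → insertRow x (r ++ [ m ]) ≡ (just b , r' ++ [ m ])) → length r' ≡ length r →
    (∀ {m} → x < m → All (_< m) r → b < m × All (_< m) r') → InsertRow x r

insertRow-view : ∀ x r → InsertRow x r
insertRow-view x [] = appends refl (insertRow-< [])
insertRow-view x (y ∷ r) with x <? y
... | yes x<y = bumps (insertRow-< r x<y) (λ m → insertRow-< (r ++ [ m ]) x<y) refl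
  λ { x<m (y<m ∷ ps) → y<m , x<m ∷ ps }
... | no x≮y with insertRow-view x r
...   | appends eq eqₘ = appends (insertRow-≮ x≮y eq) λ x<m → insertRow-≮ x≮y (eqₘ x<m)
...   | bumps eq eqₘ len bd = bumps (insertRow-≮ x≮y eq) (λ m → insertRow-≮ x≮y (eqₘ m))
  (cong suc len) λ { x<m (y<m ∷ ps) → Product.map₂ (y<m ∷_) (bd x<m ps) }

insertP-appends : ∀ x r {r'} T → insertRow x r ≡ (nothing , r') →
  insertP x (r ∷ T) ≡ (r' ∷ T , 0)
insertP-appends x r T eq rewrite eq = refl

insertP-bumps : ∀ x r {r' b i T T'} → insertRow x r ≡ (just b , r') →
  insertP b T ≡ (T' , i) → insertP x (r ∷ T) ≡ (r' ∷ T' , suc i)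
insertP-bumps x r eq eq' rewrite eq | eq' = refl

rowLength : Tableau → ℕ → ℕ
rowLength [] _ = 0
rowLength (r ∷ T) zero = length r
rowLength (r ∷ T) (suc i) = rowLength T i

record Grows (T : Tableau) (i : ℕ) (T' : Tableau) : Set where
  field
    row≤ : i ≤ length T
    row< : i < length T'
    here : rowLength T' i ≡ suc (rowLength T i)
    elsewhere : ∀ {k} → k ≢ i → rowLength T' k ≡ rowLength T k

open Grows

Grows-nil : ∀ {x} → Grows [] 0 [ [ x ] ]
Grows-nil = record { row≤ = z≤n ; row< = s≤s z≤n ; here = refl ; elsewhere = else }
  where
  else : ∀ {x k} → k ≢ 0 → rowLength [ [ x ] ] k ≡ 0
  else {k = zero} k≢0 = contradiction refl k≢0
  else {k = suc k} _ = refl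

Grows-zero : ∀ r x T → Grows (r ∷ T) 0 ((r ++ [ x ]) ∷ T)
Grows-zero r x T = record
  { row≤ = z≤n ; row< = s≤s z≤n
  ; here = trans (length-++ r) (+-comm (length r) 1) ; elsewhere = else }
  where
  else : ∀ {k} → k ≢ 0 → rowLength ((r ++ [ x ]) ∷ T) k ≡ rowLength (r ∷ T) k
  else {zero} k≢0 = contradiction refl k≢0
  else {suc k} _ = refl

Grows-suc : ∀ {r r' T i T'} → length r' ≡ length r → Grows T i T' →
  Grows (r ∷ T) (suc i) (r' ∷ T')
Grows-suc {r} {r'} {T} {i} {T'} len g = record
  { row≤ = s≤s (row≤ g) ; row< = s≤s (row< g) ; here = here g ; elsewhere = else }
  where
  else : ∀ {k} → k ≢ suc i → rowLength (r' ∷ T') k ≡ rowLength (r ∷ T) k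
  else {zero} _ = len
  else {suc k} k≢ = elsewhere g λ e → k≢ (cong suc e)

-- The bound matters: for a larger index, `addAt` would still open the first free row.
addAt-grows : ∀ m i T → i ≤ length T → Grows T i (addAt m i T)
addAt-grows m zero [] _ = Grows-nil
addAt-grows m zero (r ∷ T) _ = Grows-zero r m T
addAt-grows m (suc i) (r ∷ T) (s≤s i≤) = Grows-suc refl (addAt-grows m i T i≤)

insertP-grows : ∀ x T → Grows T (proj₂ (insertP x T)) (proj₁ (insertP x T))
insertP-grows x [] = Grows-nil
insertP-grows x (r ∷ T) with insertRow-view x r
... | appends eq _ rewrite eq = Grows-zero r x T
... | bumps {b} eq _ len _ rewrite eq = Grows-suc len (insertP-grows b T)

insertP-length : ∀ x T → length T ≤ length (proj₁ (insertP x T))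
insertP-length x [] = z≤n
insertP-length x (r ∷ T) with insertRow x r
... | nothing , _ = ≤-refl
... | just b , _ = s≤s (insertP-length b T)

_<ᵀ_ : Tableau → ℕ → Set
T <ᵀ m = All (All (_< m)) T

insertP-< : ∀ {m x T} → x < m → T <ᵀ m → proj₁ (insertP x T) <ᵀ m
insertP-< x<m [] = (x<m ∷ []) ∷ []
insertP-< {x = x} {r ∷ T} x<m (p ∷ ps) with insertRow-view x r
... | appends eq _ rewrite eq = All.++⁺ p (x<m ∷ []) ∷ ps
... | bumps {b} eq _ _ bd rewrite eq with b<m , p' ← bd x<m p = p' ∷ insertP-< b<m ps

insertP-max : ∀ {m T} → T <ᵀ m → insertP m T ≡ (addAt m 0 T , 0)
insertP-max [] = refl
insertP-max {m} {r ∷ T} (p ∷ _) = insertP-appends m r T (insertRow-max p)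

-- The row of the new cell alone separates the cases. The letter m is disturbed only if the
-- insertion reaches the end of row `i`; it is then bumped and, being maximal, comes to rest at the
-- end of the next row.
insertP-addAt : ∀ {m x} i T → i ≤ length T → x < m → T <ᵀ m →
  let T' = proj₁ (insertP x T) ; k = proj₂ (insertP x T) in
  (k ≢ i × insertP x (addAt m i T) ≡ (addAt m i T' , k)) ⊎
  (k ≡ i × insertP x (addAt m i T) ≡ (addAt m (suc i) T' , suc i))
insertP-addAt {m} {x} zero [] _ x<m _ = inj₂ (refl , insertP-bumps x [ m ] (insertRow-< [] x<m) refl)
insertP-addAt {m} {x} zero (r ∷ T) _ x<m (p ∷ ps) with insertRow-view x r
... | appends eq eqₘ rewrite eq = inj₂ (refl , insertP-bumps x (r ++ [ m ]) (eqₘ x<m) (insertP-max ps))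
... | bumps eq eqₘ _ _ rewrite eq = inj₁ ((λ ()) , insertP-bumps x (r ++ [ m ]) (eqₘ m) refl)
insertP-addAt {m} {x} (suc i) (r ∷ T) (s≤s i≤) x<m (p ∷ ps) with insertRow-view x r
... | appends eq _ rewrite eq = inj₁ ((λ ()) , refl)
... | bumps {b} eq _ _ bd rewrite eq with insertP-addAt i T i≤ (proj₁ (bd x<m p)) ps
...   | inj₁ (k≢i , e) = inj₁ ((λ e → k≢i (suc-injective e)) , cong (Product.map (_ ∷_) suc) e)
...   | inj₂ (k≡i , e) = inj₂ (cong suc k≡i , cong (Product.map (_ ∷_) suc) e)

-- Row insertion obeys the growth rule

cells : Tableau → Diagram
cells T (i , j) = j < rowLength T i

Grows-Add : ∀ {T i T'} → Grows T i T' → Add (cells T) (i , rowLength T i) (cells T')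
Grows-Add {T} {i} {T'} g = add (<-irrefl refl) (λ {p} → inc p)
  (subst (rowLength T i <_) (sym (here g)) (n<1+n _)) (λ {p} → spl p)
  where
  inc : ∀ p → cells T p → cells T' p
  inc (k , j) j< with k ≟ i
  ... | yes refl = subst (j <_) (sym (here g)) (m<n⇒m<1+n j<)
  ... | no k≢i = subst (j <_) (sym (elsewhere g k≢i)) j<
  spl : ∀ p → cells T' p → cells T p ⊎ p ≡ (i , rowLength T i)
  spl (k , j) j< with k ≟ i
  ... | no k≢i = inj₁ (subst (j <_) (elsewhere g k≢i) j<)
  ... | yes refl with m<1+n⇒m<n∨m≡n (subst (j <_) (here g) j<)
  ...   | inj₁ j<' = inj₁ j<'
  ...   | inj₂ refl = inj₂ refl

Step-insert : ∀ {m x} i T → i ≤ length T → x < m → T <ᵀ m →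
  Step NextRow (cells T) (cells (addAt m i T))
    (cells (proj₁ (insertP x T))) (cells (proj₁ (insertP x (addAt m i T))))
Step-insert {m} {x} i T i≤ x<m ps with insertP-addAt i T i≤ x<m ps
... | inj₁ (k≢i , eq) = apart (λ e → k≢i (cong row e)) (Grows-Add g) (Grows-Add (addAt-grows m i T i≤))
    (subst₂ (Add _) (cong (i ,_) len) (cong cells (sym (cong proj₁ eq)))
      (Grows-Add (addAt-grows m i _ i≤')))
  where
  g = insertP-grows x T
  len = elsewhere g λ e → k≢i (sym e)
  i≤' : i ≤ length (proj₁ (insertP x T))
  i≤' = ≤-trans i≤ (insertP-length x T)
... | inj₂ (refl , eq) = bumped (Grows-Add g) (Grows-Add (addAt-grows m i T i≤)) refl
    (subst (Add _ _) (cong cells (sym (cong proj₁ eq)))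
      -- The new cell lies in row `i`, so row `suc i` is at most the first free one.
      (Grows-Add (addAt-grows m (suc i) (proj₁ (insertP x T)) (row< g))))
  where
  g = insertP-grows x T

-- Shapes of words

insert : Tableau → ℕ → Tableau
insert T x = proj₁ (insertP x T)

P : List ℕ → Tableau
P = foldl insert []

-- `D'` builds the shape from the right end of the word: a letter prepended to `w` is the last one
-- inserted for `reverse w`. Thus it follows the growth rule of column insertion.
D D' : List ℕ → Diagram
D w = cells (P w)
D' w = D (reverse w) ᵀ

foldl-< : ∀ {m} w T → All (_< m) w → T <ᵀ m → foldl insert T w <ᵀ m
foldl-< [] T _ t = t
foldl-< (x ∷ w) T (x<m ∷ ps) t = foldl-< w _ ps (insertP-< x<m t)

P-< : ∀ {m} w → All (_< m) w → P w <ᵀ m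
P-< w ps = foldl-< w [] ps []

P-snoc : ∀ w x → P (w ++ [ x ]) ≡ insert (P w) x
P-snoc w x = foldl-++ insert [] w [ x ]

-- Each further letter leaves m in place or moves it one row down, always to the end of a row.
foldl-addAt : ∀ {m} w i T → i ≤ length T → All (_< m) w → T <ᵀ m →
  ∃[ k ] (k ≤ length (foldl insert T w) × foldl insert (addAt m i T) w ≡ addAt m k (foldl insert T w))
foldl-addAt [] i T i≤ _ _ = i , i≤ , refl
foldl-addAt (x ∷ w) i T i≤ (x<m ∷ ps) t with insertP-addAt i T i≤ x<m t
... | inj₁ (_ , eq) rewrite eq =
    foldl-addAt w i _ (≤-trans i≤ (insertP-length x T)) ps (insertP-< x<m t)
... | inj₂ (refl , eq) rewrite eq =
    foldl-addAt w (suc i) _ (row< (insertP-grows x T)) ps (insertP-< x<m t)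

P-delete-max : ∀ {m} u v → All (_< m) u → All (_< m) v →
  ∃[ k ] (k ≤ length (P (u ++ v)) × P (u ++ m ∷ v) ≡ addAt m k (P (u ++ v)))
P-delete-max {m} u v pu pv
  rewrite foldl-++ insert [] u (m ∷ v) | foldl-++ insert [] u v | insertP-max (P-< u pu)
  = foldl-addAt v 0 (P u) z≤n pv (P-< u pu)

D-snoc : ∀ w x → ∃[ c ] Add (D w) c (D (w ++ [ x ]))
D-snoc w x rewrite P-snoc w x = _ , Grows-Add (insertP-grows x (P w))

D-snoc-max : ∀ w {m} → All (_< m) w → ∃[ c ] (row c ≡ 0 × Add (D w) c (D (w ++ [ m ])))
D-snoc-max w {m} ps rewrite P-snoc w m | insertP-max (P-< w ps) =
  _ , refl , Grows-Add (addAt-grows m 0 (P w) z≤n)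

row-step : ∀ {m y} u v → All (_< m) u → All (_< m) v → y < m →
  Step NextRow (D (u ++ v)) (D (u ++ m ∷ v)) (D ((u ++ v) ++ [ y ])) (D ((u ++ m ∷ v) ++ [ y ]))
row-step {m} {y} u v pu pv y<m
  rewrite P-snoc (u ++ v) y | P-snoc (u ++ m ∷ v) y
  with k , k≤ , eq ← P-delete-max u v pu pv
  rewrite eq = Step-insert k (P (u ++ v)) k≤ y<m (P-< (u ++ v) (All.++⁺ pu pv))

reverse-mid : ∀ (u : List ℕ) m v → reverse (u ++ m ∷ v) ≡ reverse v ++ m ∷ reverse u
reverse-mid u m v = trans (reverse-++ u (m ∷ v))
  (trans (cong (_++ reverse u) (unfold-reverse m v)) (∷ʳ-++ (reverse v) m (reverse u)))

reverse-snoc : ∀ (u : List ℕ) x → reverse (u ++ [ x ]) ≡ x ∷ reverse u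
reverse-snoc u x = reverse-++ u [ x ]

reverse-ends : ∀ (x : ℕ) u y → reverse (x ∷ u ++ [ y ]) ≡ y ∷ reverse u ++ [ x ]
reverse-ends x u y =
  trans (unfold-reverse x (u ++ [ y ])) (cong (_++ [ x ]) (reverse-snoc u y))

All-reverse : ∀ {m} u → All (_< m) u → All (_< m) (reverse u)
All-reverse u ps = All-resp-↭ (↭-sym (↭-reverse u)) ps

-- This is `row-step` for the reversed words, transposed.
col-step : ∀ {m x} u v → All (_< m) u → All (_< m) v → x < m →
  Step NextCol (D' (u ++ v)) (D' (u ++ m ∷ v)) (D' (x ∷ u ++ v)) (D' (x ∷ u ++ m ∷ v))
col-step {m} {x} u v pu pv x<m
  rewrite unfold-reverse x (u ++ v) | unfold-reverse x (u ++ m ∷ v)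
        | reverse-mid u m v | reverse-++ u v =
  Step-ᵀ (λ n → n) (row-step (reverse v) (reverse u) (All-reverse v pv) (All-reverse u pu) x<m)

D'-cons : ∀ x w → ∃[ c ] Add (D' w) c (D' (x ∷ w))
D'-cons x w rewrite unfold-reverse x w with c , p ← D-snoc (reverse w) x = _ , Add-ᵀ p

Unique-resp-↭ : ∀ {u v : List ℕ} → u ↭ v → Unique u → Unique v
Unique-resp-↭ p = Permₛ.Unique-resp-↭ (setoid ℕ) (↭⇒↭ₛ p)

Unique-tail : ∀ {x : ℕ} {w} → Unique (x ∷ w) → Unique w
Unique-tail (_ ∷ q) = q

Unique-delete : ∀ {m : ℕ} u v → Unique (u ++ m ∷ v) → Unique (u ++ v)
Unique-delete u v q = Unique-tail (Unique-resp-↭ (shift _ u v) q)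

Unique-init : ∀ {y : ℕ} u → Unique (u ++ [ y ]) → Unique u
Unique-init u q = subst Unique (++-identityʳ u) (Unique-delete u [] q)

Unique-reverse : ∀ u → Unique u → Unique (reverse u)
Unique-reverse u = Unique-resp-↭ (↭-sym (↭-reverse u))

data MaxSplit : List ℕ → Set where
  split-max : ∀ u m v → All (_< m) u → All (_< m) v → MaxSplit (u ++ m ∷ v)

maxSplit : ∀ x w → Unique (x ∷ w) → MaxSplit (x ∷ w)
maxSplit x [] _ = split-max [] x [] [] []
maxSplit x (y ∷ w) (ne ∷ q) with y ∷ w | ne | maxSplit y w q
... | _ | ne | split-max u m v pu pv with <-cmp x m
...   | tri< x<m _ _ = split-max (x ∷ u) m v (x<m ∷ pu) pv
...   | tri≈ _ x≡m _ = contradiction x≡m (All.head (All.++⁻ʳ u ne))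
...   | tri> _ _ m<x = split-max [] x (u ++ m ∷ v) []
        (All.++⁺ (All.map below-x pu) (m<x ∷ All.map below-x pv))
  where
  below-x : ∀ {z} → z < m → z < x
  below-x z<m = <-trans z<m m<x

-- Shapes of words are Young diagrams

LeftClosed : Diagram → Set
LeftClosed A = ∀ {i j j'} → j' ≤ j → A (i , j) → A (i , j')

Young-top : ∀ {α c γ} → row c ≡ 0 → LeftClosed γ → Young α → Add α c γ → Young γ
Young-top refl lc yα p i'≤ j'≤ g with split p g
... | inj₁ a = incl p (yα i'≤ j'≤ a)
Young-top refl lc yα p z≤n j'≤ g | inj₂ refl = lc j'≤ g

Young-step : ∀ {α β γ δ} → LeftClosed δ → Young α → Young β → Young γ →
  Step NextRow α β γ δ → Young δ
Young-step {γ = γ} {δ} lc yα yβ yγ (apart {e = e} _ p q r) i'≤ j'≤ d with split r d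
... | inj₁ g = incl r (yγ i'≤ j'≤ g)
... | inj₂ refl with split q (yβ i'≤ j'≤ (new q))
...   | inj₁ a = incl r (incl p a)
...   | inj₂ e = subst δ (sym e) (new r)
Young-step lc yα yβ yγ (bumped p q n r) i'≤ j'≤ d with split r d
... | inj₁ g = incl r (yγ i'≤ j'≤ g)
Young-step {γ = γ} lc yα yβ yγ (bumped {i , s} {.(suc i) , t} p q refl r) {i' = i'} i'≤ j'≤ d | inj₂ refl
  with m≤n⇒m<n∨m≡n i'≤
... | inj₂ refl = lc j'≤ d
... | inj₁ (s≤s i'≤i) = incl r (yγ i'≤i (≤-trans j'≤ t≤s) (new p))
  where
  t≤s : t ≤ s
  -- If `s < t`, left closure puts the cell below `c` into `γ`, hence into `α`, and then `c` itself
  -- would lie in `α`.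
  t≤s = ≮⇒≥ λ s<t → case-split s<t (split r (lc (<⇒≤ s<t) d))
    where
    case-split : s < t → γ (suc i , s) ⊎ (suc i , s) ≡ (suc i , t) → ⊥
    case-split s<t (inj₂ e) = <⇒≢ s<t (cong col e)
    case-split _ (inj₁ g) with split p g
    ... | inj₁ a = fresh p (yα (n≤1+n i) ≤-refl a)
    ... | inj₂ e = 1+n≢n (cong row e)

cells-left : ∀ T → LeftClosed (cells T)
cells-left T j'≤j j< = ≤-<-trans j'≤j j<

length-mid : ∀ (u : List ℕ) m v → length (u ++ m ∷ v) ≡ suc (length (u ++ v))
length-mid u m v = trans (length-++ u) (trans (+-suc (length u) (length v)) (cong suc (sym (length-++ u))))

length-snoc : ∀ (u : List ℕ) y → length (u ++ [ y ]) ≡ suc (length u)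
length-snoc u y = trans (length-++ u) (+-comm (length u) 1)

-- If the maximal letter is last, it ends row 0 and `Young-top` applies. Otherwise deleting it, the
-- last letter, or both gives the three shorter words needed by `Young-step`.
D-Young-bounded : ∀ n w → length w ≤ n → Unique w → Young (D w)
D-Young-bounded n [] _ _ _ _ ()
D-Young-bounded (suc n) (x ∷ w) l q = go (maxSplit x w q) l q
  where
  delete-≤ : ∀ u m v → length (u ++ m ∷ v) ≤ suc n → length (u ++ v) ≤ n
  delete-≤ u m v l = ≤-pred (subst (_≤ suc n) (length-mid u m v) l)
  init-≤ : ∀ u y → length (u ++ [ y ]) ≤ suc n → length u ≤ n
  init-≤ u y l = ≤-pred (subst (_≤ suc n) (length-snoc u y) l)
  go : ∀ {w} → MaxSplit w → length w ≤ suc n → Unique w → Young (D w)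
  go (split-max u m v pu pv) l q with initLast v
  ... | [] with c , c-top , p ← D-snoc-max u pu =
    Young-top c-top (λ {i} → cells-left (P (u ++ [ m ])) {i})
      (D-Young-bounded n u (init-≤ u m l) (Unique-init u q)) p
  ... | v' ∷ʳ′ y
    with del-≤ ← delete-≤ u m (v' ++ [ y ]) l | del-q ← Unique-delete u (v' ++ [ y ]) q
    rewrite sym (++-assoc u (m ∷ v') [ y ]) | sym (++-assoc u v' [ y ]) =
    Young-step (λ {i} → cells-left (P ((u ++ m ∷ v') ++ [ y ])) {i})
      (D-Young-bounded n (u ++ v')
        (≤-trans (n≤1+n _) (subst (_≤ n) (length-snoc (u ++ v') y) del-≤))
        (Unique-init (u ++ v') del-q))
      (D-Young-bounded n (u ++ m ∷ v') (init-≤ (u ++ m ∷ v') y l) (Unique-init (u ++ m ∷ v') q))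
      (D-Young-bounded n ((u ++ v') ++ [ y ]) del-≤ del-q)
      (row-step u v' pu (All.++⁻ˡ v' pv) (All.head (All.++⁻ʳ v' pv)))

D-Young : ∀ w → Unique w → Young (D w)
D-Young w = D-Young-bounded (length w) w ≤-refl

D'-Young : ∀ w → Unique w → Young (D' w)
D'-Young w q = Young-ᵀ (D-Young (reverse w) (Unique-reverse w q))

-- Transposition of shapes under reversal

-- (1) and (2) are bundled for x u y because the induction uses both to prove either.
Square : ℕ → List ℕ → ℕ → Set
Square x u y = (D (x ∷ u ++ [ y ]) ≐ D' (x ∷ u ++ [ y ])) ×
  AdjacentSquare (D u) (D (x ∷ u)) (D (u ++ [ y ])) (D (x ∷ u ++ [ y ]))

Conjugate : List ℕ → Set
Conjugate w = D w ≐ D' w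

AdjacentSquare-resp : ∀ {α X Y δ α' X' Y' δ'} → α ≐ α' → X ≐ X' → Y ≐ Y' → δ ≐ δ' →
  AdjacentSquare α X Y δ → AdjacentSquare α' X' Y' δ'
AdjacentSquare-resp a x y d adj p q r =
  adj (Add-resp (≐-sym a) (≐-sym x) p) (Add-resp (≐-sym a) (≐-sym y) q)
      (Add-resp (≐-sym x) (≐-sym d) r)

AdjacentSquare-ᵀ : ∀ {α X Y δ} → AdjacentSquare α X Y δ → AdjacentSquare (α ᵀ) (Y ᵀ) (X ᵀ) (δ ᵀ)
AdjacentSquare-ᵀ {X = X} {Y} adj p q r = Adjacent-swap (adj (Add-ᵀ q) (Add-ᵀ p)
  (Add-ᵀ (Add-resp (Add-det p q) ≐-refl r)))

-- Reversal exchanges the two ends and transposes the shapes; this reduces a maximal first letter to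
-- a maximal last letter.
Square-reverse : ∀ x u y → Conjugate u → Conjugate (x ∷ u) → Conjugate (u ++ [ y ]) →
  Square y (reverse u) x → Square x u y
Square-reverse x u y cu cxu cuy (c , adj) = cxuy ,
  AdjacentSquare-resp (≐-sym cu)
    (≐-trans (subst (λ w → D (reverse u ++ [ x ]) ᵀ ≐ D w ᵀ) (sym (unfold-reverse x u)) ≐-refl) (≐-sym cxu))
    (≐-trans (subst (λ w → D (y ∷ reverse u) ᵀ ≐ D w ᵀ) (sym (reverse-snoc u y)) ≐-refl) (≐-sym cuy))
    (≐-sym δ≐)
    (AdjacentSquare-ᵀ {Y = D (reverse u ++ [ x ])} adj)
  where
  rev′ : reverse (y ∷ reverse u ++ [ x ]) ≡ x ∷ u ++ [ y ]
  rev′ = trans (cong reverse (sym (reverse-ends x u y))) (reverse-involutive (x ∷ u ++ [ y ]))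
  δ≐ : D (x ∷ u ++ [ y ]) ≐ D (y ∷ reverse u ++ [ x ]) ᵀ
  δ≐ = ≐-sym (ᵀ-resp (subst (λ w → D (y ∷ reverse u ++ [ x ]) ≐ D w ᵀ) rev′ c))
  cxuy : Conjugate (x ∷ u ++ [ y ])
  cxuy = subst (λ w → D (x ∷ u ++ [ y ]) ≐ D w ᵀ) (sym (reverse-ends x u y)) δ≐

-- The case y = m, where m always ends row 0. If x avoids `e`, then `d = e`. If x takes `e`, then
-- `d` is the cell right of it, which is also the corner in the next column required by column
-- insertion.
top-square : ∀ {α β γ δ δ' e d} → Young α → Young γ → Young δ → Young δ' →
  Step NextCol α β γ δ' → row e ≡ 0 → Add α e β → row d ≡ 0 → Add γ d δ →
  (δ ≐ δ') × AdjacentSquare α γ β δ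
top-square yα yγ yδ yδ' (apart c≢e p q r) e-top e+ d-top d+
  with refl ← cell-unique q e+
  with refl ← row-unique yδ yδ' d+ r (trans d-top (sym e-top)) =
  Add-det d+ r , λ p' q' _ → contradiction (trans (cell-unique p p') (cell-unique q' q)) c≢e
top-square {δ = δ} yα yγ yδ yδ' (bumped p q n r) e-top e+ d-top d+
  with refl ← cell-unique q e+
  with refl ← same-row yα yγ yδ p d+ (trans d-top (sym e-top)) =
  Add-det d+ (subst (λ c → Add _ c _) (sym (col-unique yδ yδ' d+ r (sym n))) r) , adj
  where
  adj : AdjacentSquare _ _ _ δ
  adj p' q' r' with refl ← cell-unique p p' | refl ← cell-unique d+ r' = inj₁ refl

data MaxView (x : ℕ) (u : List ℕ) (y : ℕ) : Set where
  first : All (_< x) (u ++ [ y ]) → MaxView x u y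
  last  : All (_< y) (x ∷ u) → MaxView x u y
  mid   : ∀ u₁ m u₂ → u ≡ u₁ ++ m ∷ u₂ → All (_< m) (x ∷ u₁) → All (_< m) (u₂ ++ [ y ]) →
    MaxView x u y

maxView : ∀ x u y → Unique (x ∷ u ++ [ y ]) → MaxView x u y
maxView x u y q = go (maxSplit x (u ++ [ y ]) q) refl
  where
  go : ∀ {w} → MaxSplit w → w ≡ x ∷ u ++ [ y ] → MaxView x u y
  go (split-max [] m v _ pv) refl = first pv
  go (split-max (z ∷ u₁) m v pu pv) eq with initLast v
  ... | [] with refl , eq' ← ∷-injective eq with refl , refl ← ∷ʳ-injective u₁ u eq' = last pu
  ... | u₂ ∷ʳ′ y' with refl , eq' ← ∷-injective eq
      with refl , refl ← ∷ʳ-injective (u₁ ++ m ∷ u₂) u (trans (++-assoc u₁ (m ∷ u₂) [ y' ]) eq') =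
      mid u₁ m u₂ refl pu pv

Squares : ℕ → Set
Squares n = ∀ x u y → length u < n → Unique (x ∷ u ++ [ y ]) → Square x u y

-- A word x u y of length at most `suc n` has `length u < n`, so only words with fewer than two
-- letters need a direct check.
conjugate-bounded : ∀ {n} → Squares n → ∀ w → length w ≤ suc n → Unique w → Conjugate w
conjugate-bounded sq [] _ _ = (λ ()) , (λ ())
conjugate-bounded {n} sq (x ∷ w) l q with initLast w
... | [] = (λ {p} → to p) , (λ {p} → from p)
  where
  to : ∀ p → D [ x ] p → D' [ x ] p
  to (zero , zero) _ = s≤s z≤n
  to (zero , suc _) (s≤s ())
  from : ∀ p → D' [ x ] p → D [ x ] p
  from (zero , zero) _ = s≤s z≤n
  from (suc _ , zero) (s≤s ())
... | u ∷ʳ′ y = proj₁ (sq x u y (≤-pred (subst (_≤ suc n) (cong suc (length-snoc u y)) l)) q)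

module _ {n} (sq : Squares n) where
  private
    conj : ∀ w → length w ≤ suc n → Unique w → Conjugate w
    conj = conjugate-bounded sq

  last-square : ∀ x u m → length u ≤ n → Unique (x ∷ u ++ [ m ]) → All (_< m) (x ∷ u) → Square x u m
  last-square x u m l q (x<m ∷ pu)
    with e , e-top , e+ ← D-snoc-max u pu
       | d , d-top , d+ ← D-snoc-max (x ∷ u) (x<m ∷ pu) =
    top-square (D-Young u qu) (D-Young (x ∷ u) qxu) (D-Young _ q) (D'-Young _ q)
      step e-top e+ d-top d+
    where
    qxu = Unique-init (x ∷ u) q
    qu = Unique-tail qxu
    id-u : ∀ (A : List ℕ → Diagram) → A (u ++ []) ≐ A u
    id-u A = subst (λ w → A (u ++ []) ≐ A w) (++-identityʳ u) ≐-refl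
    step : Step NextCol (D u) (D (u ++ [ m ])) (D (x ∷ u)) (D' (x ∷ u ++ [ m ]))
    step = Step-resp
      (≐-trans (id-u D') (≐-sym (conj u (m≤n⇒m≤1+n l) qu)))
      (≐-sym (conj (u ++ [ m ]) (subst (_≤ suc n) (sym (length-snoc u m)) (s≤s l)) (Unique-tail q)))
      (≐-trans (id-u (λ w → D' (x ∷ w))) (≐-sym (conj (x ∷ u) (s≤s l) qxu)))
      ≐-refl
      (col-step u [] pu [] x<m)

  square-step : ∀ x u y → length u ≤ n → Unique (x ∷ u ++ [ y ]) → Square x u y
  square-step x u y l q with maxView x u y q
  ... | last p = last-square x u y l q p
  ... | first p = Square-reverse x u y (conj u (m≤n⇒m≤1+n l) (Unique-tail (Unique-init (x ∷ u) q)))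
      (conj (x ∷ u) (s≤s l) (Unique-init (x ∷ u) q))
      (conj (u ++ [ y ]) (subst (_≤ suc n) (sym (length-snoc u y)) (s≤s l)) (Unique-tail q))
      (last-square y (reverse u) x (subst (_≤ n) (sym (length-reverse u)) l)
        (subst Unique (reverse-ends x u y) (Unique-reverse _ q))
        (subst (All (_< x)) (reverse-snoc u y) (All-reverse (u ++ [ y ]) p)))
  ... | mid u₁ m u₂ refl (x<m ∷ p₁) p₂y = cube-conclusion record
    { yβ = D-Young _ qβ ; yX₀ = D-Young _ qX₀ ; yX = D-Young _ qX
    ; yY₀ = D-Young _ qY₀ ; yY = D-Young _ qY ; yγ = D-Young _ qγ
    ; yδ = D-Young _ q ; yδ' = D'-Young _ q
    ; u∙y = row-step u₁ u₂ p₁ p₂ y<m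
    ; x∙u = Step-resp (≐-sym (conj _ (m≤n⇒m≤1+n lα) qα)) (≐-sym (conj _ (m≤n⇒m≤1+n l) qβ))
        (≐-sym (conj _ (s≤s lα) qX₀)) (≐-sym (conj _ (s≤s l) qX)) (col-step u₁ u₂ p₁ p₂ x<m)
    ; xu∙y = row-step (x ∷ u₁) u₂ (x<m ∷ p₁) p₂ y<m
    -- Three corners are rewritten from `D'` to `D` by induction. The fourth stays `D'`, as
    -- conjugacy of the whole word is what the cube yields.
    ; x∙uy = Step-resp (≐-sym (conj _ lY₀ qY₀)) (≐-sym (conj _ lY qY))
        (≐-sym (conj _ lγ qγ)) ≐-refl x∙uy
    ; adj = proj₂ (sq x (u₁ ++ u₂) y l₀ qγ)
    }
    where
    p₂ = All.++⁻ˡ u₂ p₂y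
    y<m = All.head (All.++⁻ʳ u₂ p₂y)
    l₀ : length (u₁ ++ u₂) < n
    l₀ = subst (_≤ n) (length-mid u₁ m u₂) l
    lα = <⇒≤ l₀
    lγ : length (x ∷ (u₁ ++ u₂) ++ [ y ]) ≤ suc n
    lγ = s≤s (subst (_≤ n) (sym (length-snoc (u₁ ++ u₂) y)) l₀)
    lY₀ = ≤-trans (n≤1+n _) lγ
    lY : length ((u₁ ++ m ∷ u₂) ++ [ y ]) ≤ suc n
    lY = subst (_≤ suc n) (sym (length-snoc (u₁ ++ m ∷ u₂) y)) (s≤s l)
    qX = Unique-init (x ∷ u₁ ++ m ∷ u₂) q
    qβ = Unique-tail qX
    qX₀ = Unique-delete (x ∷ u₁) u₂ qX
    qα = Unique-tail qX₀
    qY = Unique-tail q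
    qγ : Unique (x ∷ (u₁ ++ u₂) ++ [ y ])
    qγ = subst (λ w → Unique (x ∷ w)) (sym (++-assoc u₁ u₂ [ y ]))
      (Unique-delete (x ∷ u₁) (u₂ ++ [ y ]) (subst (λ w → Unique (x ∷ w)) (++-assoc u₁ (m ∷ u₂) [ y ]) q))
    qY₀ = Unique-tail qγ
    x∙uy : Step NextCol (D' ((u₁ ++ u₂) ++ [ y ])) (D' ((u₁ ++ m ∷ u₂) ++ [ y ]))
      (D' (x ∷ (u₁ ++ u₂) ++ [ y ])) (D' (x ∷ (u₁ ++ m ∷ u₂) ++ [ y ]))
    x∙uy rewrite ++-assoc u₁ u₂ [ y ] | ++-assoc u₁ (m ∷ u₂) [ y ] = col-step u₁ (u₂ ++ [ y ]) p₁ p₂y x<m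

squares : ∀ n → Squares n
squares (suc n) x u y (s≤s l) = square-step (squares n) x u y l

conjugate : ∀ w → Unique w → Conjugate w
conjugate w = conjugate-bounded (squares (length w)) w (n≤1+n _)

adjacentSquare : ∀ x u y → Unique (x ∷ u ++ [ y ]) →
  AdjacentSquare (D u) (D (x ∷ u)) (D (u ++ [ y ])) (D (x ∷ u ++ [ y ]))
adjacentSquare x u y q = proj₂ (squares (suc (length u)) x u y ≤-refl q)

-- Recording tableaux

-- Up to reversing both words, this is equality of recording tableaux.
data SuffixShapes : List ℕ → List ℕ → Set where
  []  : SuffixShapes [] []
  _∷_ : ∀ {x u y v} → D (x ∷ u) ≐ D (y ∷ v) → SuffixShapes u v → SuffixShapes (x ∷ u) (y ∷ v)

SuffixShapes-D : ∀ {u v} → SuffixShapes u v → D u ≐ D v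
SuffixShapes-D [] = ≐-refl
SuffixShapes-D (e ∷ _) = e

D-cons : ∀ x w → Unique (x ∷ w) → ∃[ c ] Add (D w) c (D (x ∷ w))
D-cons x w q with c , p ← D'-cons x w =
  c , Add-resp (≐-sym (conjugate w (Unique-tail q))) (≐-sym (conjugate (x ∷ w) q)) p

-- Adding `f` without `e` would leave a hole at `e`, directly left of or above `f`.
adjacent-not-addable : ∀ {α e f X Y} → Young X → Adjacent e f → Add α e Y → ¬ Add α f X
adjacent-not-addable yX (inj₁ refl) p q with split q (yX ≤-refl (n≤1+n _) (new q))
... | inj₁ a = fresh p a
... | inj₂ e = 1+n≢n (sym (cong col e))
adjacent-not-addable yX (inj₂ refl) p q with split q (yX (n≤1+n _) ≤-refl (new q))
... | inj₁ a = fresh p a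
... | inj₂ e = 1+n≢n (sym (cong row e))

-- A cell `c` other than `e` must be `f`. If instead `c = e`, then `f` is adjacent to `e` and so not
-- addable to `α`. The two alternatives therefore exclude each other.
square-determined : ∀ {α X X' Y δ c c' e f} → Young X → Young X' →
  AdjacentSquare α X Y δ → AdjacentSquare α X' Y δ → X ⊆ δ → X' ⊆ δ →
  Add α e Y → Add Y f δ → Add α c X → Add α c' X' → c ≡ c'
square-determined {c = c} {c'} {e} yX yX' adj adj' X⊆ X'⊆ e+ f+ c+ c'+ with c ≟ᶜ e | c' ≟ᶜ e
... | yes refl | yes refl = refl
... | no c≢e | no c'≢e = trans (sym (other-cell (λ p → c≢e (sym p)) e+ c+ f+ X⊆))
    (other-cell (λ p → c'≢e (sym p)) e+ c'+ f+ X'⊆)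
... | yes refl | no c'≢e with refl ← other-cell (λ p → c'≢e (sym p)) e+ c'+ f+ X'⊆ =
    contradiction c'+ (adjacent-not-addable yX'
      (adj c+ e+ (Add-resp (Add-det e+ c+) ≐-refl f+)) e+)
... | no c≢e | yes refl with refl ← other-cell (λ p → c≢e (sym p)) e+ c+ f+ X⊆ =
    contradiction c+ (adjacent-not-addable yX
      (adj' c'+ e+ (Add-resp (Add-det e+ c'+) ≐-refl f+)) e+)

-- For each pair of suffixes, the shapes of u, u x and a u x agree with those of v, v y and b v y,
-- by induction and hypothesis; `square-determined` supplies the remaining corner.
SuffixShapes-init : ∀ u v {x y} → Unique (u ++ [ x ]) → Unique (v ++ [ y ]) →
  SuffixShapes (u ++ [ x ]) (v ++ [ y ]) → SuffixShapes u v
SuffixShapes-init [] [] _ _ _ = []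
SuffixShapes-init [] (_ ∷ []) _ _ (_ ∷ ())
SuffixShapes-init [] (_ ∷ _ ∷ _) _ _ (_ ∷ ())
SuffixShapes-init (_ ∷ []) [] _ _ (_ ∷ ())
SuffixShapes-init (_ ∷ _ ∷ _) [] _ _ (_ ∷ ())
SuffixShapes-init (a ∷ u) (b ∷ v) {x} {y} q q' (h ∷ s)
  with c , c+ ← D-cons a u (Unique-init (a ∷ u) q)
     | c' , c'+ ← D-cons b v (Unique-init (b ∷ v) q')
     | e , e+ ← D-snoc u x
     | f , f+ ← D-cons a (u ++ [ x ]) q = eq ∷ ih
  where
  ih = SuffixShapes-init u v (Unique-tail q) (Unique-tail q') s
  u≐v = SuffixShapes-D ih
  X⊆ : ∀ w z → D w ⊆ D (w ++ [ z ])
  X⊆ w z = incl (proj₂ (D-snoc w z))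
  c'+′ : Add (D u) c' (D (b ∷ v))
  c'+′ = Add-resp (≐-sym u≐v) ≐-refl c'+
  c≡c' : c ≡ c'
  c≡c' = square-determined
    (D-Young (a ∷ u) (Unique-init (a ∷ u) q)) (D-Young (b ∷ v) (Unique-init (b ∷ v) q'))
    (adjacentSquare a u x q)
    (AdjacentSquare-resp (≐-sym u≐v) ≐-refl (≐-sym (SuffixShapes-D s)) (≐-sym h)
      (adjacentSquare b v y q'))
    (X⊆ (a ∷ u) x) (λ p → proj₂ h (X⊆ (b ∷ v) y p)) e+ f+ c+ c'+′
  eq : D (a ∷ u) ≐ D (b ∷ v)
  eq = Add-det c+ (subst (λ z → Add (D u) z (D (b ∷ v))) (sym c≡c') c'+′)

-- From recording tableaux to shapes of suffixes

rsGo-P : ∀ k w T S → proj₁ (rsGo k w T S) ≡ foldl insert T w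
rsGo-P k [] T S = refl
rsGo-P k (x ∷ w) T S = rsGo-P (suc k) w _ _

rsGo-Q-snoc : ∀ k w y T S → proj₂ (rsGo k (w ++ [ y ]) T S) ≡
  addAt (k + length w) (proj₂ (insertP y (foldl insert T w))) (proj₂ (rsGo k w T S))
rsGo-Q-snoc k [] y T S rewrite +-identityʳ k = refl
rsGo-Q-snoc k (x ∷ w) y T S rewrite +-suc k (length w) = rsGo-Q-snoc (suc k) w y _ _

recording : List ℕ → Tableau
recording w = proj₂ (RS w)

recording-snoc : ∀ w y → recording (w ++ [ y ]) ≡
  addAt (suc (length w)) (proj₂ (insertP y (P w))) (recording w)
recording-snoc w y = rsGo-Q-snoc 1 w y [] []

-- Empty rows are invisible in `cells`; excluding them makes the list of row lengths recoverable
-- from the set of cells.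
NonEmptyRows : Tableau → Set
NonEmptyRows = All (_≢ [])

addAt-nonEmpty : ∀ m i {T} → NonEmptyRows T → NonEmptyRows (addAt m i T)
addAt-nonEmpty m zero [] = (λ ()) ∷ []
addAt-nonEmpty m zero {r ∷ T} (_ ∷ ps) = snoc≢[] r ∷ ps
  where
  snoc≢[] : ∀ r → r ++ [ m ] ≢ []
  snoc≢[] [] ()
  snoc≢[] (_ ∷ _) ()
addAt-nonEmpty m (suc i) [] = (λ ()) ∷ []
addAt-nonEmpty m (suc i) (p ∷ ps) = p ∷ addAt-nonEmpty m i ps

addAt-< : ∀ {m n} i {T} → m < n → T <ᵀ n → addAt m i T <ᵀ n
addAt-< zero m<n [] = (m<n ∷ []) ∷ []
addAt-< zero m<n (p ∷ ps) = All.++⁺ p (m<n ∷ []) ∷ ps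
addAt-< (suc i) m<n [] = (m<n ∷ []) ∷ []
addAt-< (suc i) m<n (p ∷ ps) = p ∷ addAt-< i m<n ps

addAt-nil : ∀ m i → addAt m i [] ≡ [ [ m ] ]
addAt-nil m zero = refl
addAt-nil m (suc i) = refl

addAt-cons : ∀ {m} i {r T} → r ≢ [] → All (_< m) r → addAt m i (r ∷ T) ≢ [ [ m ] ]
addAt-cons zero {[]} n _ _ = n refl
addAt-cons zero {_ ∷ []} _ _ ()
addAt-cons zero {_ ∷ _ ∷ _} _ _ ()
addAt-cons (suc i) _ p eq with refl ← proj₁ (∷-injective eq) = <-irrefl refl (All.head p)

-- Since m exceeds every other entry, it can be located and removed. Non-emptiness distinguishes
-- opening a new row from filling an empty one.
addAt-injective : ∀ {m} i i' {T T'} → NonEmptyRows T → NonEmptyRows T' → T <ᵀ m → T' <ᵀ m →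
  addAt m i T ≡ addAt m i' T' → T ≡ T'
addAt-injective i i' [] [] _ _ _ = refl
addAt-injective zero zero {r ∷ _} {r' ∷ _} _ _ _ _ eq with e , refl ← ∷-injective eq
  = cong (_∷ _) (proj₁ (∷ʳ-injective r r' e))
addAt-injective zero (suc i') {r ∷ _} _ _ _ (p' ∷ _) eq with refl , _ ← ∷-injective eq =
  contradiction (All.head (All.++⁻ʳ r p')) (<-irrefl refl)
addAt-injective (suc i) zero {_} {r' ∷ _} _ _ (p ∷ _) _ eq with refl , _ ← ∷-injective eq =
  contradiction (All.head (All.++⁻ʳ r' p)) (<-irrefl refl)
addAt-injective (suc i) (suc i') (_ ∷ n) (_ ∷ n') (_ ∷ p) (_ ∷ p') eq
  with refl , e ← ∷-injective eq = cong (_ ∷_) (addAt-injective i i' n n' p p' e)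
addAt-injective {m} i i' {T' = r ∷ T'} [] (n ∷ _) _ (p ∷ _) eq =
  contradiction (trans (sym eq) (addAt-nil m i)) (addAt-cons i' n p)
addAt-injective {m} i i' {r ∷ T} (n ∷ _) [] (p ∷ _) _ eq =
  contradiction (trans eq (addAt-nil m i')) (addAt-cons i n p)

insertP-shape : ∀ x k T S → shape T ≡ shape S →
  shape (insert T x) ≡ shape (addAt k (proj₂ (insertP x T)) S)
insertP-shape x k [] [] _ = refl
insertP-shape x k (r ∷ T) (s ∷ S) eq with lr , lT ← ∷-injective eq with insertRow-view x r
... | appends e _ rewrite e = cong₂ _∷_
    (trans (length-snoc r x) (trans (cong suc lr) (sym (length-snoc s k)))) lT
... | bumps {b} e _ len _ rewrite e = cong₂ _∷_ (trans len lr) (insertP-shape b k T S lT)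

snoc-induction : (R : List ℕ → Set) → R [] → (∀ w y → R w → R (w ++ [ y ])) → ∀ w → R w
snoc-induction R base step w = subst R (reverse-involutive w) (go (reverse w))
  where
  go : ∀ w → R (reverse w)
  go [] = base
  go (x ∷ w) = subst R (sym (unfold-reverse x w)) (step (reverse w) x (go w))

recording-shape : ∀ w → shape (P w) ≡ shape (recording w)
recording-shape = snoc-induction _ refl λ w y ih →
  trans (cong shape (P-snoc w y)) (trans (insertP-shape y _ (P w) (recording w) ih)
    (cong shape (sym (recording-snoc w y))))

recording-nonEmpty : ∀ w → NonEmptyRows (recording w)
recording-nonEmpty = snoc-induction _ [] λ w y ih →
  subst NonEmptyRows (sym (recording-snoc w y)) (addAt-nonEmpty _ _ ih)

recording-< : ∀ w → recording w <ᵀ suc (length w)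
recording-< = snoc-induction _ [] λ w y ih →
  subst₂ _<ᵀ_ (sym (recording-snoc w y)) (cong suc (sym (length-snoc w y)))
    (addAt-< _ (n<1+n _) (All.map (All.map m<n⇒m<1+n) ih))

rowLength-shape : ∀ T S → shape T ≡ shape S → ∀ i → rowLength T i ≡ rowLength S i
rowLength-shape [] [] _ _ = refl
rowLength-shape (r ∷ T) (s ∷ S) eq zero = proj₁ (∷-injective eq)
rowLength-shape (r ∷ T) (s ∷ S) eq (suc i) = rowLength-shape T S (proj₂ (∷-injective eq)) i

cells-shape : ∀ T S → shape T ≡ shape S → cells T ≐ cells S
cells-shape T S eq =
  (λ { {i , j} → subst (j <_) (rowLength-shape T S eq i) }) ,
  (λ { {i , j} → subst (j <_) (sym (rowLength-shape T S eq i)) })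

recording-D : ∀ u v → recording u ≡ recording v → D u ≐ D v
recording-D u v eq = cells-shape (P u) (P v)
  (trans (recording-shape u) (trans (cong shape eq) (sym (recording-shape v))))

recording-init : ∀ u v {x y} → length u ≡ length v →
  recording (u ++ [ x ]) ≡ recording (v ++ [ y ]) → recording u ≡ recording v
recording-init u v {x} {y} l eq = addAt-injective _ _
  (recording-nonEmpty u) (recording-nonEmpty v)
  (recording-< u) (subst (λ n → recording v <ᵀ suc n) (sym l) (recording-< v))
  (trans (sym (recording-snoc u x)) (trans eq (trans (recording-snoc v y)
    (cong (λ n → addAt (suc n) (proj₂ (insertP y (P v))) (recording v)) (sym l)))))

-- Prefixes of the reversed words are reversed suffixes of `u` and `v`, and `conjugate` carries the
-- equality of their shapes over to the suffixes.
recording-SuffixShapes : ∀ u v → Unique u → Unique v → length u ≡ length v →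
  recording (reverse u) ≡ recording (reverse v) → SuffixShapes u v
recording-SuffixShapes [] [] _ _ _ _ = []
recording-SuffixShapes (x ∷ u) (y ∷ v) q q' l eq =
  ≐-trans (conjugate (x ∷ u) q)
    (≐-trans (ᵀ-resp (recording-D (reverse (x ∷ u)) (reverse (y ∷ v)) eq))
      (≐-sym (conjugate (y ∷ v) q'))) ∷
  recording-SuffixShapes u v (Unique-tail q) (Unique-tail q') (suc-injective l)
    (recording-init (reverse u) (reverse v)
      (trans (length-reverse u) (trans (suc-injective l) (sym (length-reverse v))))
      (trans (cong recording (sym (unfold-reverse x u)))
        (trans eq (cong recording (unfold-reverse y v)))))

-- Symmetric hooks

Hook : ℕ → Diagram
Hook k (i , j) = (i ≡ 0 × j ≤ k) ⊎ (j ≡ 0 × i ≤ k)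

Symmetric : Diagram → Set
Symmetric A = A ⊆ A ᵀ

record TwoMore (A : Diagram) (c d : Cell) (W : Diagram) : Set where
  field
    young : Young W
    youngᴬ : Young A
    symᵂ  : Symmetric W
    symᴬ  : Symmetric A
    sub   : A ⊆ W
    Wc    : W c
    Wd    : W d
    A∌c   : ¬ A c
    A∌d   : ¬ A d
    c≢d   : c ≢ d
    cover : ∀ {p} → W p → A p ⊎ p ≡ c ⊎ p ≡ d

  flip : TwoMore A d c W
  flip = record { young = young ; youngᴬ = youngᴬ ; symᵂ = λ {p} → symᵂ {p} ; symᴬ = λ {p} → symᴬ {p}
    ; sub = sub ; Wc = Wd ; Wd = Wc ; A∌c = A∌d ; A∌d = A∌c
    ; c≢d = λ e → c≢d (sym e) ; cover = λ w → Sum.map₂ Sum.swap (cover w) }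

  swap-c : swap c ≡ c ⊎ swap c ≡ d
  swap-c with cover (symᵂ {c} Wc)
  ... | inj₁ a = contradiction (symᴬ {swap c} a) A∌c
  ... | inj₂ e = e

open TwoMore

diagonal-unique : ∀ {A s t W} → TwoMore A (s , s) (t , t) W → ¬ s < t
diagonal-unique p s<t with cover p (young p (<⇒≤ s<t) ≤-refl (Wd p))
... | inj₁ a = A∌c p (youngᴬ p ≤-refl (<⇒≤ s<t) a)
... | inj₂ (inj₁ e) = <⇒≢ s<t (sym (cong col e))
... | inj₂ (inj₂ e) = <⇒≢ s<t (cong row e)

-- If transposition fixed one of the two new cells it would fix both, and a Young diagram
-- with two more diagonal cells also has off-diagonal ones.
no-diagonal : ∀ {A s c W} → ¬ TwoMore A (s , s) c W
no-diagonal {s = s} {i , _} p with swap-c (flip p)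
... | inj₂ e = c≢d p (cong swap (sym e))
... | inj₁ refl with <-cmp s i
...   | tri≈ _ refl _ = c≢d p refl
...   | tri< s<i _ _ = diagonal-unique p s<i
...   | tri> _ _ i<s = diagonal-unique (flip p) i<s

-- The origin would be one of the new cells, and it is diagonal.
no-empty : ∀ {A c d W} → (∀ {p} → ¬ A p) → ¬ TwoMore A c d W
no-empty empty p with cover p (young p z≤n z≤n (Wc p))
... | inj₁ a = empty a
... | inj₂ (inj₁ refl) = no-diagonal p
... | inj₂ (inj₂ refl) = no-diagonal (flip p)

extend-arm : ∀ {k b d W} → TwoMore (Hook k) (0 , b) d W → W ≐ Hook (suc k)
extend-arm {k} {b} {d} {W} p with swap-c p
... | inj₁ refl = contradiction p no-diagonal
... | inj₂ refl = (λ {q} → to q) , (λ {q} → from q)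
  where
  k<b : k < b
  k<b = ≰⇒> λ b≤k → A∌c p (inj₁ (refl , b≤k))
  b≡ : b ≡ suc k
  -- The cell `(0 , suc k)` lies in `W` but outside the hook, so it is new. It is not the other new
  -- cell, which lies in column 0.
  b≡ with cover p (young p {i' = 0} {j' = suc k} z≤n k<b (Wc p))
  ... | inj₁ (inj₁ (_ , 1+k≤k)) = contradiction 1+k≤k 1+n≰n
  ... | inj₂ (inj₁ e) = sym (cong col e)
  ... | inj₂ (inj₂ e) = contradiction (cong col e) λ ()
  to : ∀ q → W q → Hook (suc k) q
  to q w with cover p w
  ... | inj₁ (inj₁ (e , l)) = inj₁ (e , m≤n⇒m≤1+n l)
  ... | inj₁ (inj₂ (e , l)) = inj₂ (e , m≤n⇒m≤1+n l)
  ... | inj₂ (inj₁ refl) = inj₁ (refl , ≤-reflexive b≡)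
  ... | inj₂ (inj₂ refl) = inj₂ (refl , ≤-reflexive b≡)
  from : ∀ q → Hook (suc k) q → W q
  from q (inj₁ (refl , l)) = young p z≤n (≤-trans l (≤-reflexive (sym b≡))) (Wc p)
  from q (inj₂ (refl , l)) = young p (≤-trans l (≤-reflexive (sym b≡))) z≤n (Wd p)

extend-hook : ∀ {k c d W} → TwoMore (Hook k) c d W → W ≐ Hook (suc k)
extend-hook {c = zero , b} p = extend-arm p
extend-hook {c = suc a , zero} p with swap-c p
... | inj₂ refl = extend-arm (flip p)
-- An interior cell forces `(1 , 1)` into `W`; being outside the hook, this diagonal cell would be
-- new.
extend-hook {c = suc a , suc b} p with cover p (young p {i' = 1} {j' = 1} (s≤s z≤n) (s≤s z≤n) (Wc p))
... | inj₂ (inj₁ refl) = contradiction p no-diagonal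
... | inj₂ (inj₂ refl) = contradiction (flip p) no-diagonal
... | inj₁ (inj₁ (() , _))
... | inj₁ (inj₂ (() , _))

TwoMore-resp : ∀ {A B c d W} → A ≐ B → TwoMore A c d W → TwoMore B c d W
TwoMore-resp (f , g) p = record
  { young = young p ; youngᴬ = λ i≤ j≤ b → f (youngᴬ p i≤ j≤ (g b))
  ; symᵂ = λ {q} → symᵂ p {q} ; symᴬ = λ {q} b → f (symᴬ p {q} (g b))
  ; sub = λ b → sub p (g b) ; Wc = Wc p ; Wd = Wd p
  ; A∌c = λ b → A∌c p (g b) ; A∌d = λ b → A∌d p (g b) ; c≢d = c≢d p
  ; cover = λ w → Sum.map₁ f (cover p w) }

ReverseInvariant : List ℕ → Set
ReverseInvariant w = SuffixShapes (reverse w) w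

-- Dropping the heads is immediate, and `SuffixShapes-init` drops the last letters; the reversal of
-- `u` and `u` itself remain.
ReverseInvariant-inner : ∀ x u y → Unique (x ∷ u ++ [ y ]) →
  ReverseInvariant (x ∷ u ++ [ y ]) → ReverseInvariant u
ReverseInvariant-inner x u y q s
  rewrite reverse-ends x u y with _ ∷ s' ← s =
  SuffixShapes-init (reverse u) u
    (subst Unique (unfold-reverse x u) (Unique-reverse (x ∷ u) (Unique-init (x ∷ u) q)))
    (Unique-tail q) s'

-- Reversal transposes the shape by `conjugate` and preserves it by invariance.
ReverseInvariant-symmetric : ∀ w → Unique w → ReverseInvariant w → Symmetric (D w)
ReverseInvariant-symmetric w q s {p} d =
  proj₁ (SuffixShapes-D s) {swap p} (proj₁ (conjugate w q) d)

ReverseInvariant-hook : ∀ n x w → length w ≤ n → Unique (x ∷ w) → ReverseInvariant (x ∷ w) →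
  ∃[ k ] D (x ∷ w) ≐ Hook k
ReverseInvariant-hook n x w l q s with initLast w
... | [] = 0 , (λ {p} → to p) , (λ {p} → from p)
  where
  to : ∀ p → D [ x ] p → Hook 0 p
  to (zero , zero) _ = inj₁ (refl , z≤n)
  to (zero , suc _) (s≤s ())
  from : ∀ p → Hook 0 p → D [ x ] p
  from _ (inj₁ (refl , z≤n)) = s≤s z≤n
  from _ (inj₂ (refl , z≤n)) = s≤s z≤n
ReverseInvariant-hook n x _ l q s | u ∷ʳ′ y
  with c , c+ ← D-cons x u (Unique-init (x ∷ u) q) | d , d+ ← D-snoc (x ∷ u) y = go n u refl l
  where
  qu = Unique-tail (Unique-init (x ∷ u) q)
  su = ReverseInvariant-inner x u y q s
  two : TwoMore (D u) c d (D (x ∷ u ++ [ y ]))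
  two = record
    { young = D-Young _ q ; youngᴬ = D-Young u qu
    ; symᵂ = λ {p} → ReverseInvariant-symmetric _ q s {p}
    ; symᴬ = λ {p} → ReverseInvariant-symmetric u qu su {p}
    ; sub = λ a → incl d+ (incl c+ a)
    ; Wc = incl d+ (new c+) ; Wd = new d+
    ; A∌c = fresh c+ ; A∌d = λ a → fresh d+ (incl c+ a)
    ; c≢d = λ { refl → fresh d+ (new c+) }
    ; cover = cov
    }
    where
    cov : ∀ {p} → D (x ∷ u ++ [ y ]) p → D u p ⊎ p ≡ c ⊎ p ≡ d
    cov w with split d+ w
    ... | inj₂ e = inj₂ (inj₂ e)
    ... | inj₁ b = Sum.map₂ inj₁ (split c+ b)
  -- The bound `n` makes the recursion structural; it drops by one while the word loses two letters.
  go : ∀ n v → v ≡ u → length (u ++ [ y ]) ≤ n → ∃[ k ] D (x ∷ u ++ [ y ]) ≐ Hook k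
  go n [] refl _ = contradiction two (no-empty λ ())
  go (suc n) (z ∷ v) refl l
    with k , h ← ReverseInvariant-hook n z v
           (≤-trans (n≤1+n _) (≤-pred (subst (_≤ suc n) (cong suc (length-snoc v y)) l))) qu su
    = suc k , extend-hook (TwoMore-resp h two)

-- From sets of cells to lists of row lengths

<-determines : ∀ {a b} → (∀ {j} → j < a → j < b) → (∀ {j} → j < b → j < a) → a ≡ b
<-determines f g = ≤-antisym (≮⇒≥ λ b<a → <-irrefl refl (f b<a)) (≮⇒≥ λ a<b → <-irrefl refl (g a<b))

column-shape : ∀ k T → NonEmptyRows T →
  cells T ≐ (λ (i , j) → j ≡ 0 × i < k) → shape T ≡ replicate k 1
column-shape zero [] _ _ = refl
column-shape (suc k) [] _ (_ , g) with () ← g {0 , 0} (refl , s≤s z≤n)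
column-shape _ ([] ∷ T) (n ∷ _) _ = contradiction refl n
column-shape zero ((_ ∷ _) ∷ T) _ (f , _) with () ← proj₂ (f {0 , 0} (s≤s z≤n))
column-shape (suc k) (r@(_ ∷ _) ∷ T) (_ ∷ ns) (f , g) = cong₂ _∷_
  (<-determines (λ {j} l → s≤s (≤-reflexive (proj₁ (f {0 , j} l)))) λ { {zero} _ → s≤s z≤n ; {suc _} (s≤s ()) })
  (column-shape k T ns
    ( (λ { {i , j} l → Product.map₂ ≤-pred (f {suc i , j} l) })
    , (λ { {i , j} (e , l) → g {suc i , j} (e , s≤s l) })))

hook-shape : ∀ k T → NonEmptyRows T → cells T ≐ Hook k → shape T ≡ suc k ∷ replicate k 1
hook-shape k [] _ (_ , g) with () ← g {0 , 0} (inj₁ (refl , z≤n))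
hook-shape k (r ∷ T) (_ ∷ ns) (f , g) = cong₂ _∷_
  (<-determines (λ {j} l → to j (f {0 , j} l)) λ {j} l → g {0 , j} (inj₁ (refl , ≤-pred l)))
  (column-shape k T ns ((λ { {i , j} l → below-arm (f {suc i , j} l) })
    , (λ { {i , j} (e , l) → g {suc i , j} (inj₂ (e , l)) })))
  where
  to : ∀ j → Hook k (0 , j) → j < suc k
  to j (inj₁ (_ , l)) = s≤s l
  to .0 (inj₂ (refl , _)) = s≤s z≤n
  below-arm : ∀ {i j} → Hook k (suc i , j) → j ≡ 0 × i < k
  below-arm (inj₂ p) = p

applyUpTo-const : ∀ {g : ℕ → ℕ} {c} k → (∀ {j} → j < k → g j ≡ c) → applyUpTo g k ≡ replicate k c
applyUpTo-const zero _ = refl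
applyUpTo-const (suc k) h = cong₂ _∷_ (h (s≤s z≤n)) (applyUpTo-const k λ l → h (s≤s l))

-- Column 0 meets all `suc k` rows, and each of the other `k` columns meets only the first.
transpose-hook : ∀ k → transpose (suc k ∷ replicate k 1) ≡ suc k ∷ replicate k 1
transpose-hook k = cong₂ _∷_
  (trans (cong length (filter-all (1 ≤?_) nonZero))
    (cong suc (length-replicate k)))
  (trans (map-applyUpTo suc columnLength k) (applyUpTo-const k λ {j} j<k →
    cong length (trans (filter-accept (suc (suc j) ≤?_) (s≤s j<k))
      (cong (suc k ∷_) (filter-none (suc (suc j) ≤?_) (All.replicate⁺ k λ { (s≤s ()) }))))))
  where
  nonZero : All (1 ≤_) (suc k ∷ replicate k 1)
  nonZero = s≤s z≤n ∷ All.replicate⁺ k ≤-refl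
  columnLength : ℕ → ℕ
  columnLength j = length (filter (suc j ≤?_) (suc k ∷ replicate k 1))

-- Application to permutations

oneLine-unique : ∀ {n} (w : Permutation′ n) → Unique (oneLine w)
oneLine-unique {n} w = Unique.map⁺ (λ e → Injection.injective (↔⇒↣ w) (toℕ-injective e)) (Unique.allFin⁺ n)

length-oneLine : ∀ {n} (w : Permutation′ n) → length (oneLine w) ≡ n
length-oneLine {n} w = trans (length-map _ (allFin n)) (length-tabulate {n = n} λ i → i)

recording-symmetricHook : ∀ w → w ≢ [] → Unique w → recording w ≡ recording (reverse w) →
  IsSymmetricHook (shape (recording w))
recording-symmetricHook [] w≢[] _ _ = contradiction refl w≢[]
recording-symmetricHook w@(x ∷ u) _ q eq
  with k , h ← ReverseInvariant-hook (length u) x u ≤-refl q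
         -- This lemma reads its words backwards, so the hypothesis enters as a comparison of
         -- `reverse (reverse w)` with `reverse w`.
         (recording-SuffixShapes (reverse w) w (Unique-reverse w q) q (length-reverse w)
           (trans (cong recording (reverse-involutive w)) eq))
  with e ← hook-shape k (recording w) (recording-nonEmpty w)
         (≐-trans (cells-shape (recording w) (P w) (sym (recording-shape w))) h)
  = (k , k , e) , trans (cong transpose e) (trans (transpose-hook k) (sym e))

theorem2p8 : (n : ℕ) → 1 ≤ n → (w : Permutation′ n) →
    Q w ≡ Qrev w → IsSymmetricHook (shape (Q w))
theorem2p8 n 1≤n w = recording-symmetricHook (oneLine w) nonEmpty (oneLine-unique w)
  where
  nonEmpty : oneLine w ≢ []
  nonEmpty e = contradiction (subst (1 ≤_) (trans (sym (length-oneLine w)) (cong length e)) 1≤n) λ ()
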